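{- Let $a,b$ be integers with $2\le a\le b$, and let $G$ be a connected graph of order $n\ge 4a+\frac{5b}{2}+11$ with minimum degree $\delta(G)\ge a+1$. If $$e(G)\ge \binom{n-b-1}{2}+ab+2a+b+1,$$ then $G$ is a fractional $[a,b]$-covered graph.
   Context: All graphs are finite, simple and undirected; $e(G)$ is the number of edges of $G$. For a function $h:E(G)\to[0,1]$, let $E_h=\{e\in E(G): h(e)>0\}$; if $a\le \sum_{e\ni u} h(e)\le b$ for every vertex $u$ (sum over edges incident with $u$), then $G[E_h]$ is a fractional $[a,b]$-factor of $G$ with indicator function $h$. A graph $G$ is a fractional $[a,b]$-covered graph if for every edge $e$ of $G$ there exists a fractional $[a,b]$-factor of $G$ with indicator function $h$ such that $h(e)=1$. -}

module Defs where

open import Data.Nat as ℕ using (ℕ; zero; suc)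
open import Data.Bool using (Bool; true; false; _∧_)
open import Data.Fin as Fin using (Fin; toℕ)
open import Data.List using (List; filterᵇ; length; foldr; map; concatMap; allFin)
open import Data.Rational as ℚ using (ℚ; 0ℚ; 1ℚ; _≤_; _/_)
open import Data.Integer using (+_)
open import Data.Product using (Σ; _×_; _,_)
open import Relation.Binary.PropositionalEquality using (_≡_)

record Graph (n : ℕ) : Set where
  field
    adj    : Fin n → Fin n → Bool
    sym    : ∀ i j → adj i j ≡ adj j i
    irrefl : ∀ i → adj i i ≡ false
open Graph public

nbrs : ∀ {n} → Graph n → Fin n → List (Fin n)
nbrs {n} G u = filterᵇ (adj G u) (allFin n)

degree : ∀ {n} → Graph n → Fin n → ℕ
degree G u = length (nbrs G u)

minDegree≥ : ∀ {n} → Graph n → ℕ → Set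
minDegree≥ G d = ∀ u → d ℕ.≤ degree G u

numEdges : ∀ {n} → Graph n → ℕ
numEdges {n} G =
  length (concatMap (λ i → filterᵇ (λ j → (toℕ i ℕ.<ᵇ toℕ j) ∧ adj G i j) (allFin n)) (allFin n))

data Reach {n} (G : Graph n) : Fin n → Fin n → Set where
  here : ∀ {u} → Reach G u u
  step : ∀ {u v w} → adj G u v ≡ true → Reach G v w → Reach G u w

Connected : ∀ {n} → Graph n → Set
Connected G = ∀ u v → Reach G u v

ℕ→ℚ : ℕ → ℚ
ℕ→ℚ k = + k / 1

sumℚ : List ℚ → ℚ
sumℚ = foldr ℚ._+_ 0ℚ

-- An edge function: a value h i j for each ordered pair, symmetric,
-- so that it is a function on the (unordered) edges; values on
-- non-edges are irrelevant (never used).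
EdgeFun : ℕ → Set
EdgeFun n = Fin n → Fin n → ℚ

incSum : ∀ {n} → Graph n → EdgeFun n → Fin n → ℚ
incSum G h u = sumℚ (map (h u) (nbrs G u))

IsFracFactor : ∀ {n} → Graph n → ℕ → ℕ → EdgeFun n → Set
IsFracFactor {n} G a b h =
  (∀ i j → h i j ≡ h j i) ×
  (∀ i j → adj G i j ≡ true → (0ℚ ≤ h i j) × (h i j ≤ 1ℚ)) ×
  (∀ u → (ℕ→ℚ a ≤ incSum G h u) × (incSum G h u ≤ ℕ→ℚ b))

FracCovered : ∀ {n} → Graph n → ℕ → ℕ → Set
FracCovered {n} G a b =
  ∀ i j → adj G i j ≡ true →
    Σ (EdgeFun n) λ h → IsFracFactor G a b h × (h i j ≡ 1ℚ)

{-# OPTIONS --safe #-}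
-- A 0/1 matrix x supported on the adjacency matrix of G, with x i j = x j i = 1 and all row and
-- column sums in [a , b], gives the fractional factor h = (x + xᵀ) / 2 with h(ij) = 1. Such an x is
-- built by augmenting along alternating paths. When augmentation gets stuck, the rows T reachable
-- from a deficient row and the full columns S satisfy b|S| + e(T , V∖S) < a|T| + 2. Passing to
-- (V∖S , V∖T) if necessary, |S| + |T| ≤ n. The minimum degree then forces |T| > b, and since T sees
-- little outside S, there are at most C(n−t , 2) + ts + e(T , V∖S) edges, with s = |S| and t = |T|.
-- Writing t = b + 1 + τ, the bound s ≤ a + 1 + τ (for small τ) or s ≤ n − t (for large τ) shows that
-- this is fewer than assumed.
module Submission where

open import Defs
open import Data.Nat using (ℕ; zero; suc; _≤_; _<_; _+_; _*_; _∸_; z≤n; s≤s; s≤s⁻¹; _<ᵇ_)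
open import Data.Nat.Properties
open import Data.Nat.Combinatorics using (_C_; nC1≡n; nCk+nC[k+1]≡[n+1]C[k+1])
open import Data.Nat.Tactic.RingSolver using (solve; solve-∀)
open import Data.Integer as ℤ using (ℤ)
import Data.Integer.Properties as ℤ
open import Data.Integer.Tactic.RingSolver using () renaming (solve-∀ to solveℤ-∀)
open import Data.Rational as ℚ using (ℚ; 0ℚ; 1ℚ; _/_; toℚᵘ)
import Data.Rational.Properties as ℚ
open import Data.Rational.Unnormalised as ℚᵘ using (mkℚᵘ; *≡*; *≤*)
import Data.Rational.Unnormalised.Properties as ℚᵘ
open import Data.Fin using (Fin; zero; suc; toℕ)
import Data.Fin.Properties as Fin
open import Data.Bool using (Bool; true; false; T; _∧_; _∨_; not; if_then_else_)
open import Data.Bool.Properties using (not-involutive; ∨-comm; ∧-comm) renaming (_≟_ to _≟ᵇ_)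
open import Data.List using (List; []; _∷_; map; length; filterᵇ; concatMap; tabulate; allFin)
open import Data.List.Properties using (length-++)
open import Data.Empty using (⊥; ⊥-elim)
open import Data.Unit using (tt)
open import Data.Sum using (_⊎_; inj₁; inj₂)
open import Data.Product using (Σ; ∃; ∃-syntax; _×_; _,_)
open import Function using (_∘_; flip; id)
open import Relation.Nullary using (¬_; Dec; yes; no; does; contradiction)
open import Relation.Nullary.Decidable using (dec-true; dec-false; _×-dec_; _⊎-dec_)
open import Relation.Unary using (Decidable)
import Relation.Binary as B
open import Relation.Binary.PropositionalEquality using (_≡_; _≢_; refl; trans; cong; cong₂; subst; subst₂; module ≡-Reasoning) renaming (sym to ≡-sym)
open import Algebra.Properties.Semiring.Sum +-*-semiring using (sum; sum-cong-≗; ∑-distrib-+; ∑-comm; *-distribˡ-sum; *-distribʳ-sum)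
open ≡-Reasoning

private variable n : ℕ

-- Arithmetic of a violated cut

-- Polynomial estimates are certified by adding multiples of known inequalities: both sides of the
-- sum expand to a common part `c` plus the two sides of the claim, which the ring solver checks.
cancel-≤ : ∀ c {l r p q} → l ≤ r → l ≡ c + p → r ≡ c + q → p ≤ q
cancel-≤ c l≤r refl refl = +-cancelˡ-≤ c _ _ l≤r

2*nC2+n≡n*n : ∀ n → 2 * (n C 2) + n ≡ n * n
2*nC2+n≡n*n zero    = refl
2*nC2+n≡n*n (suc n) = begin
  2 * (suc n C 2) + suc n          ≡⟨ cong (λ c → 2 * c + suc n) (nCk+nC[k+1]≡[n+1]C[k+1] n 1) ⟨
  2 * (n C 1 + n C 2) + suc n      ≡⟨ cong (λ c → 2 * (c + n C 2) + suc n) (nC1≡n n) ⟩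
  2 * (n + n C 2) + suc n          ≡⟨ rearrange n (n C 2) ⟩
  (2 * (n C 2) + n) + (2 * n + 1)  ≡⟨ cong (_+ (2 * n + 1)) (2*nC2+n≡n*n n) ⟩
  n * n + (2 * n + 1)              ≡⟨ solve (n ∷ []) ⟩
  suc n * suc n                    ∎
  where
  rearrange : ∀ n c → 2 * (n + c) + suc n ≡ (2 * c + n) + (2 * n + 1)
  rearrange = solve-∀

-- Adding the two bounds gives `(b − t) s + t ≤ 1`. For `t ≤ b` and `s ≥ 1` the left side is at
-- least `b`, against `b ≥ 2`.
b<t : ∀ a {b s t k} → 2 ≤ b → 1 ≤ s → b * s + k ≤ a * t + 1 → (a + 1) * t ≤ k + s * t → b < t
b<t a {b} {suc s} {t} {k} 2≤b _ defect degrees = ≰⇒> λ t≤b → <⇒≱ 2≤b (b≤1 t≤b)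
  where
  b≤1 : t ≤ b → b ≤ 1
  b≤1 t≤b = cancel-≤ (b * s + s * t + t + k + a * t) total
    (solve (a ∷ b ∷ s ∷ t ∷ k ∷ [])) (solve (a ∷ b ∷ s ∷ t ∷ k ∷ []))
    where
    total : (b * (1 + s) + k) + (a + 1) * t + s * t ≤ (a * t + 1) + (k + (1 + s) * t) + s * b
    total = +-mono-≤ (+-mono-≤ defect degrees) (*-monoʳ-≤ s t≤b)

-- If `s ≥ a + 2 + τ`, then `(2 + τ) b ≤ (1 + τ) a + 1 ≤ (1 + τ) b + 1`, so `b ≤ 1`.
s≤a+1+τ : ∀ {a b s} τ → 2 ≤ b → a ≤ b → b * s ≤ a * (b + 1 + τ) + 1 → s ≤ a + 1 + τ
s≤a+1+τ {a} {b} {s} τ 2≤b a≤b bs≤ = ≮⇒≥ λ large → <⇒≱ 2≤b (b≤1 large)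
  where
  b≤1 : a + 1 + τ < s → b ≤ 1
  b≤1 large = cancel-≤ (b * s + a * b + b + b * τ + a + a * τ) total
    (solve (a ∷ b ∷ s ∷ τ ∷ [])) (solve (a ∷ b ∷ s ∷ τ ∷ []))
    where
    total : b * s + b * (1 + (a + 1 + τ)) + (1 + τ) * a ≤ (a * (b + 1 + τ) + 1) + b * s + (1 + τ) * b
    total = +-mono-≤ (+-mono-≤ bs≤ (*-monoʳ-≤ b large)) (*-monoʳ-≤ (1 + τ) a≤b)

-- Here t = b + 1 + τ and n = m + t.
surplus-bound : ∀ {a b m s} τ {k e} →
  b * s + k ≤ a * (b + 1 + τ) + 1 →
  (m + τ) C 2 + a * b + 2 * a + b + 1 ≤ e →
  2 * e + m ≤ m * m + 2 * ((b + 1 + τ) * s + k) →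
  2 * (m * τ) + τ * τ + 2 * a + 2 * b ≤ 2 * ((1 + τ) * s) + 2 * (a * τ) + τ
surplus-bound {a} {b} {m} {s} τ {k} {e} defect many few = go ((m + τ) C 2) many (2*nC2+n≡n*n (m + τ))
  where
  -- With the binomial coefficient generalised to `c`, only polynomials are left for the ring
  -- solver.
  go : ∀ c → c + a * b + 2 * a + b + 1 ≤ e → 2 * c + (m + τ) ≡ (m + τ) * (m + τ) →
    2 * (m * τ) + τ * τ + 2 * a + 2 * b ≤ 2 * ((1 + τ) * s) + 2 * (a * τ) + τ
  go c many′ 2c≡ =
    cancel-≤ (2 * e + m + m * m + 2 * c + 2 * (a * b) + 2 * a + 2 * (b * s) + 2 * k + 2) total
      (solve (a ∷ b ∷ m ∷ s ∷ τ ∷ k ∷ e ∷ c ∷ [])) (solve (a ∷ b ∷ m ∷ s ∷ τ ∷ k ∷ e ∷ c ∷ []))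
    where
    -- Doubling clears the denominator of the binomial coefficient. Then `k` cancels between
    -- `defect` and `few`, `e` between `many′` and `few`, and `c` between `many′` and its defining
    -- equation.
    total : 2 * (b * s + k) + 2 * (c + a * b + 2 * a + b + 1) + (2 * e + m) + (m + τ) * (m + τ) ≤
      2 * (a * (b + 1 + τ) + 1) + 2 * e + (m * m + 2 * ((b + 1 + τ) * s + k)) + (2 * c + (m + τ))
    total = +-mono-≤ (+-mono-≤ (+-mono-≤ (*-monoʳ-≤ 2 defect) (*-monoʳ-≤ 2 many′)) few)
      (≤-reflexive (≡-sym 2c≡))

-- Inserting `s ≤ a + 1 + τ` into the last hypothesis leaves `2mτ + 2b ≤ τ (τ + 4a + 5) + 2`, which
-- is absurd once `2m ≥ τ + 4a + 5`; this dictates the case split. In the other case `s ≤ m` is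
-- inserted instead.
no-surplus : ∀ {a b m s} τ → 2 ≤ a → a ≤ b → s ≤ m → s ≤ a + 1 + τ →
  8 * a + 5 * b + 22 ≤ 2 * (m + (b + 1 + τ)) →
  2 * (m * τ) + τ * τ + 2 * a + 2 * b ≤ 2 * ((1 + τ) * s) + 2 * (a * τ) + τ → ⊥
no-surplus {a} {b} {m} {s} τ 2≤a a≤b s≤m s≤ large surplus with ≤-<-connex (τ + 4 * a + 5) (2 * m)
... | inj₁ τ-small = <⇒≱ (≤-trans 2≤a a≤b) (*-cancelˡ-≤ 2 2b≤2)
  where
  total : (2 * (m * τ) + τ * τ + 2 * a + 2 * b) + 2 * (1 + τ) * s + τ * (τ + 4 * a + 5) ≤
    (2 * ((1 + τ) * s) + 2 * (a * τ) + τ) + 2 * (1 + τ) * (a + 1 + τ) + τ * (2 * m)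
  total = +-mono-≤ (+-mono-≤ surplus (*-monoʳ-≤ (2 * (1 + τ)) s≤)) (*-monoʳ-≤ τ τ-small)
  2b≤2 : 2 * b ≤ 2 * 1
  2b≤2 = cancel-≤ (2 * (m * τ) + 2 * (τ * τ) + 2 * a + 2 * ((1 + τ) * s) + 4 * (a * τ) + 5 * τ) total
    (solve (a ∷ b ∷ m ∷ s ∷ τ ∷ [])) (solve (a ∷ b ∷ m ∷ s ∷ τ ∷ []))
... | inj₂ τ-large = <⇒≱ 1<τ (*-cancelˡ-≤ 4 4τ≤4)
  where
  -- The bound on the order, with `2m ≤ τ + 4a + 4`, gives `3τ ≥ 4a + 3b + 16`, which is at least
  -- `6a + 18` because `b ≥ a ≥ 2`.
  2a+6≤τ : 2 * a + 6 ≤ τ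
  2a+6≤τ = *-cancelˡ-≤ 3 (cancel-≤ (5 * a + 5 * b + 2 * m + 7) total
    (solve (a ∷ b ∷ m ∷ τ ∷ [])) (solve (a ∷ b ∷ m ∷ τ ∷ [])))
    where
    total : (8 * a + 5 * b + 22) + (1 + 2 * m) + 3 * a + 2 ≤ 2 * (m + (b + 1 + τ)) + (τ + 4 * a + 5) + 3 * b + a
    total = +-mono-≤ (+-mono-≤ (+-mono-≤ large τ-large) (*-monoʳ-≤ 3 a≤b)) 2≤a
  1<τ : 1 < τ
  1<τ = ≤-trans (s≤s (s≤s z≤n)) (≤-trans (m≤n+m 6 (2 * a)) 2a+6≤τ)
  -- With `s ≤ m` the terms `2mτ` cancel, leaving `τ² + 2a + 2b ≤ 2m + 2aτ + τ`; now
  -- `τ² ≥ (2a + 6) τ` outweighs the right side.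
  4τ≤4 : 4 * τ ≤ 4 * 1
  4τ≤4 = cancel-≤ (2 * (m * τ) + 2 * ((1 + τ) * s) + τ * τ + 2 * m + 4 * a + 2 * b + 2 * (a * τ) + 2 * τ + 1)
    total (solve (a ∷ b ∷ m ∷ s ∷ τ ∷ [])) (solve (a ∷ b ∷ m ∷ s ∷ τ ∷ []))
    where
    total : (2 * (m * τ) + τ * τ + 2 * a + 2 * b) + 2 * (1 + τ) * s + (1 + 2 * m) + τ * (2 * a + 6) + 2 * a ≤
      (2 * ((1 + τ) * s) + 2 * (a * τ) + τ) + 2 * (1 + τ) * m + (τ + 4 * a + 5) + τ * τ + 2 * b
    total = +-mono-≤ (+-mono-≤ (+-mono-≤ (+-mono-≤ surplus (*-monoʳ-≤ (2 * (1 + τ)) s≤m)) τ-large)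
      (*-monoʳ-≤ τ 2a+6≤τ)) (*-monoʳ-≤ 2 a≤b)

-- Intended reading: `s` and `t` are the sizes of `S` and `T`, `m` that of `V∖T`, `k` is
-- `e(T , V∖S)` and `e` the number of edges. The hypotheses are the violated cut, the degree bound
-- on `T`, and the lower and upper bounds on `e`.
violation-impossible : ∀ {a b n m s t k e} → 2 ≤ a → a ≤ b → 1 ≤ s → s ≤ m → t + m ≡ n →
  8 * a + 5 * b + 22 ≤ 2 * n →
  b * s + k ≤ a * t + 1 → (a + 1) * t ≤ k + s * t →
  (n ∸ b ∸ 1) C 2 + a * b + 2 * a + b + 1 ≤ e →
  2 * e + m ≤ m * m + 2 * (t * s + k) → ⊥
violation-impossible {a} {b} {n} {m} {s} {t} {k} {e} 2≤a a≤b 1≤s s≤m t+m≡n large defect degrees many few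
  with m≤n⇒∃[o]m+o≡n (b<t a (≤-trans 2≤a a≤b) 1≤s defect degrees)
... | τ , b+τ<t with trans (cong (_+ τ) (+-comm b 1)) b+τ<t | t+m≡n
... | refl | refl = no-surplus τ 2≤a a≤b s≤m
  (s≤a+1+τ τ (≤-trans 2≤a a≤b) a≤b (≤-trans (m≤m+n _ _) defect))
  (subst (λ n → 8 * a + 5 * b + 22 ≤ 2 * n) (+-comm (b + 1 + τ) m) large)
  (surplus-bound {a} τ defect (subst (λ N → N C 2 + a * b + 2 * a + b + 1 ≤ e) order many) few)
  where
  rearrange : b + 1 + τ + m ≡ b + (1 + (m + τ))
  rearrange = solve (b ∷ τ ∷ m ∷ [])
  -- Since `t > b`, the truncated subtractions are exact.
  order : b + 1 + τ + m ∸ b ∸ 1 ≡ m + τ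
  order = trans (cong (λ k → k ∸ b ∸ 1) rearrange) (cong (_∸ 1) (m+n∸m≡n b _))

-- Counting with Boolean matrices

sum-mono-≤ : {f g : Fin n → ℕ} → (∀ i → f i ≤ g i) → sum f ≤ sum g
sum-mono-≤ {zero}  f≤g = z≤n
sum-mono-≤ {suc n} f≤g = +-mono-≤ (f≤g zero) (sum-mono-≤ (f≤g ∘ suc))

sum-mono-< : {f g : Fin n → ℕ} → (∀ i → f i ≤ g i) → ∀ i → f i < g i → sum f < sum g
sum-mono-< f≤g zero    fi<gi = +-mono-<-≤ fi<gi (sum-mono-≤ (f≤g ∘ suc))
sum-mono-< f≤g (suc i) fi<gi = +-mono-≤-< (f≤g zero) (sum-mono-< (f≤g ∘ suc) i fi<gi)

fᵢ≤sum : (f : Fin n → ℕ) → ∀ i → f i ≤ sum f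
fᵢ≤sum f zero    = m≤m+n _ _
fᵢ≤sum f (suc i) = ≤-trans (fᵢ≤sum (f ∘ suc) i) (m≤n+m _ _)

ι : Bool → ℕ
ι true  = 1
ι false = 0

δ : Fin n → Fin n → ℕ
δ i j = ι (does (i Fin.≟ j))

δ-refl : (i : Fin n) → δ i i ≡ 1
δ-refl i = cong ι (dec-true (i Fin.≟ i) refl)

δ-≢ : {i j : Fin n} → i ≢ j → δ i j ≡ 0
δ-≢ {i = i} {j} i≢j = cong ι (dec-false (i Fin.≟ j) i≢j)

sum-zero : ∀ n → sum {n} (λ _ → 0) ≡ 0
sum-zero zero    = refl
sum-zero (suc n) = sum-zero n

sum-one : ∀ n → sum {n} (λ _ → 1) ≡ n
sum-one zero    = refl
sum-one (suc n) = cong suc (sum-one n)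

sum-δ : (j : Fin n) → sum (λ i → δ i j) ≡ 1
sum-δ {suc n} zero    = cong suc (trans (sum-cong-≗ {n} (λ i → δ-≢ {i = suc i} {zero} λ ())) (sum-zero n))
sum-δ {suc n} (suc j) = sum-δ j

Subset : ℕ → Set
Subset n = Fin n → Bool

Matrix : ℕ → Set
Matrix n = Fin n → Fin n → Bool

∣_∣ : Subset n → ℕ
∣ T ∣ = sum (λ i → ι (T i))

∁ : Subset n → Subset n
∁ T i = not (T i)

ι+ι-not : ∀ b → ι b + ι (not b) ≡ 1
ι+ι-not true  = refl
ι+ι-not false = refl

∣T∣+∣∁T∣≡n : (T : Subset n) → ∣ T ∣ + ∣ ∁ T ∣ ≡ n
∣T∣+∣∁T∣≡n {n} T = begin
  ∣ T ∣ + ∣ ∁ T ∣                    ≡⟨ ∑-distrib-+ (ι ∘ T) (ι ∘ ∁ T) ⟨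
  sum (λ i → ι (T i) + ι (∁ T i))  ≡⟨ sum-cong-≗ (λ i → ι+ι-not (T i)) ⟩
  sum {n} (λ _ → 1)                ≡⟨ sum-one n ⟩
  n                                ∎

∣T∣≡0⇒empty : (T : Subset n) → ∣ T ∣ ≡ 0 → ∀ i → T i ≡ false
∣T∣≡0⇒empty T ∣T∣≡0 i with T i in Ti
... | false = refl
... | true  = contradiction (subst₂ _≤_ (cong ι Ti) ∣T∣≡0 (fᵢ≤sum (ι ∘ T) i)) λ ()

row : Matrix n → Fin n → ℕ
row x u = sum (λ v → ι (x u v))

-- Ordered pairs are counted, so for a symmetric matrix an edge inside the intersection of `T` and
-- `S` contributes 2.
between : Subset n → Subset n → Matrix n → ℕ
between T S x = sum (λ u → sum (λ v → ι (T u ∧ S v ∧ x u v)))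

-- Simple paths and closed sets

open import Data.List.Relation.Unary.All as All using (All; []; _∷_)

module _ {n} (_⟶_ : Fin n → Fin n → Set) where

  -- The list holds the vertices after the start, so simplicity says that each start is fresh for
  -- its list.
  data SimplePath (z : Fin n) : Fin n → List (Fin n) → Set where
    []   : SimplePath z z []
    step : ∀ {u w ws} → u ⟶ w → All (u ≢_) (w ∷ ws) → SimplePath z w ws → SimplePath z u (w ∷ ws)

  module _ (_⟶?_ : B.Decidable _⟶_) {Goal : Fin n → Set} (goal? : Decidable Goal) (s : Fin n) where

    Reached : Set
    Reached = ∃[ z ] Goal z × ∃[ ws ] SimplePath z s ws

    Closed : Set
    Closed = Σ (Subset n) λ T → T s ≡ true × (∀ u → T u ≡ true → ¬ Goal u) ×
      (∀ {u w} → u ⟶ w → T u ≡ true → T w ≡ true)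

    private
      -- The search runs backwards from the goals. Paths stay inside `K`, so a vertex newly put in
      -- front of one cannot already lie on it.
      Good : Subset n → Set
      Good K = (∀ u → Goal u → K u ≡ true) ×
        (∀ u → K u ≡ true → ∃[ z ] Goal z × ∃[ ws ] SimplePath z u ws × All (λ w → K w ≡ true) ws)

      -- The fuel `k` bounds the number of vertices outside `K`, which drops with each addition.
      -- Once no arrow leads from outside into `K`, the complement is closed.
      grow : ∀ k K → ∣ ∁ K ∣ < k → Good K → Reached ⊎ Closed
      grow (suc k) K (s≤s ∣∁K∣≤k) (goals , paths) with K s in Ks
      ... | true = let z , gz , ws , p , _ = paths s Ks in inj₁ (z , gz , ws , p)
      ... | false with Fin.any? (λ u → (K u ≟ᵇ false) ×-dec Fin.any? (λ w → (K w ≟ᵇ true) ×-dec (u ⟶? w)))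
      ...   | no stuck = inj₂ (∁ K , cong not Ks , no-goal , closed)
        where
        no-goal : ∀ u → ∁ K u ≡ true → ¬ Goal u
        no-goal u u∉K gu rewrite goals u gu = contradiction u∉K λ ()
        closed : ∀ {u w} → u ⟶ w → ∁ K u ≡ true → ∁ K w ≡ true
        closed {u} {w} u⟶w u∉K with K u in Ku | K w in Kw
        ... | false | false = refl
        ... | false | true  = ⊥-elim (stuck (u , Ku , w , Kw , u⟶w))
      ...   | yes (u , Ku , w , Kw , u⟶w) = grow k K′ (≤-trans smaller ∣∁K∣≤k) (goals′ , paths′)
        where
        K′ : Subset n
        K′ v = does (v Fin.≟ u) ∨ K v
        K⊆K′ : ∀ {v} → K v ≡ true → K′ v ≡ true
        K⊆K′ {v} Kv with does (v Fin.≟ u)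
        ... | true  = refl
        ... | false = Kv
        K′u : K′ u ≡ true
        K′u rewrite dec-true (u Fin.≟ u) refl = refl
        smaller : ∣ ∁ K′ ∣ < ∣ ∁ K ∣
        smaller = sum-mono-< le u (subst₂ _<_ (cong (ι ∘ not) (≡-sym K′u)) (cong (ι ∘ not) (≡-sym Ku)) (s≤s z≤n))
          where
          le : ∀ v → ι (∁ K′ v) ≤ ι (∁ K v)
          le v with does (v Fin.≟ u)
          ... | true  = z≤n
          ... | false = ≤-refl
        goals′ : ∀ v → Goal v → K′ v ≡ true
        goals′ v = K⊆K′ ∘ goals v
        avoids : ∀ {v} → K v ≡ true → u ≢ v
        avoids Kv refl = contradiction (trans (≡-sym Ku) Kv) λ ()
        paths′ : ∀ v → K′ v ≡ true → ∃[ z ] Goal z × ∃[ ws ] SimplePath z v ws × All (λ w → K′ w ≡ true) ws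
        paths′ v K′v with v Fin.≟ u
        ... | yes refl = let z , gz , ws , p , ws⊆K = paths w Kw in
          z , gz , w ∷ ws , step u⟶w (All.map avoids (Kw ∷ ws⊆K)) p , All.map K⊆K′ (Kw ∷ ws⊆K)
        ... | no _     = let z , gz , ws , p , ws⊆K = paths v K′v in
          z , gz , ws , p , All.map K⊆K′ ws⊆K

    reached-or-closed : Reached ⊎ Closed
    reached-or-closed = grow (suc ∣ ∁ goals ∣) goals ≤-refl
      ((λ u gu → dec-true (goal? u) gu) , paths)
      where
      goals : Subset n
      goals u = does (goal? u)
      paths : ∀ u → goals u ≡ true → ∃[ z ] Goal z × ∃[ ws ] SimplePath z u ws × All (λ w → goals w ≡ true) ws
      paths u gu with goal? u
      ... | yes g = u , g , [] , [] , []

-- Augmentation along alternating paths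

set : Matrix n → Fin n → Fin n → Bool → Matrix n
set x u v β r c = if does (r Fin.≟ u) ∧ does (c Fin.≟ v) then β else x r c

set-row : (x : Matrix n) {u r : Fin n} (v : Fin n) (β : Bool) → r ≢ u → ∀ c → set x u v β r c ≡ x r c
set-row x {u} {r} v β r≢u c rewrite dec-false (r Fin.≟ u) r≢u = refl

set-false : (x : Matrix n) (u v r c : Fin n) → x r c ≡ false → set x u v false r c ≡ false
set-false x u v r c xrc with does (r Fin.≟ u) ∧ does (c Fin.≟ v)
... | true  = refl
... | false = xrc

set-true : (x : Matrix n) (u v r c : Fin n) → x r c ≡ true → set x u v true r c ≡ true
set-true x u v r c xrc with does (r Fin.≟ u) ∧ does (c Fin.≟ v)
... | true  = refl
... | false = xrc

-- `y` is `x` plus a matrix unit. In this additive form, deleting an entry is the same relation read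
-- backwards, without subtraction.
Extends : Fin n → Fin n → Matrix n → Matrix n → Set
Extends u v x y = ∀ r c → ι (y r c) ≡ ι (x r c) + δ r u * δ c v

set-true-extends : (x : Matrix n) (u v : Fin n) → x u v ≡ false → Extends u v x (set x u v true)
set-true-extends x u v xuv r c with r Fin.≟ u | c Fin.≟ v
... | yes refl | yes refl rewrite xuv = refl
... | yes _    | no _     = ≡-sym (+-identityʳ _)
... | no _     | _        = ≡-sym (+-identityʳ _)

set-false-extends : (x : Matrix n) (u v : Fin n) → x u v ≡ true → Extends u v (set x u v false) x
set-false-extends x u v xuv r c with r Fin.≟ u | c Fin.≟ v
... | yes refl | yes refl rewrite xuv = refl
... | yes _    | no _     = ≡-sym (+-identityʳ _)
... | no _     | _        = ≡-sym (+-identityʳ _)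

flip-extends : {x y : Matrix n} {u v : Fin n} → Extends u v x y → Extends v u (flip x) (flip y)
flip-extends {x = x} {u = u} {v} ext r c = trans (ext c r) (cong (ι (x c r) +_) (*-comm (δ c u) (δ r v)))

row-extends : {x y : Matrix n} {u v : Fin n} → Extends u v x y → ∀ r → row y r ≡ row x r + δ r u
row-extends {x = x} {y} {u} {v} ext r = begin
  row y r                                        ≡⟨ sum-cong-≗ (ext r) ⟩
  sum (λ c → ι (x r c) + δ r u * δ c v)          ≡⟨ ∑-distrib-+ (λ c → ι (x r c)) _ ⟩
  row x r + sum (λ c → δ r u * δ c v)            ≡⟨ cong (row x r +_) (*-distribˡ-sum (δ r u) (λ c → δ c v)) ⟨
  row x r + δ r u * sum (λ c → δ c v)            ≡⟨ cong (λ k → row x r + δ r u * k) (sum-δ v) ⟩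
  row x r + δ r u * 1                            ≡⟨ cong (row x r +_) (*-identityʳ (δ r u)) ⟩
  row x r + δ r u                                ∎

-- `A` holds the allowed entries and `F` those fixed at 1. Their symmetry lets columns be treated as
-- rows of the transpose.
module Augmentation {n} (A F : Matrix n) (A-sym : ∀ i j → A i j ≡ A j i) (F-sym : ∀ i j → F i j ≡ F j i) where

  record Admissible (x : Matrix n) : Set where
    field
      F⊆x : ∀ r c → F r c ≡ true → x r c ≡ true
      x⊆A : ∀ r c → x r c ≡ true → A r c ≡ true
  open Admissible

  flip-admissible : ∀ {x} → Admissible x → Admissible (flip x)
  flip-admissible adm .F⊆x r c Frc = F⊆x adm c r (trans (F-sym c r) Frc)
  flip-admissible adm .x⊆A r c xcr = trans (A-sym r c) (x⊆A adm c r xcr)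

  set-true-admissible : ∀ {x u v} → A u v ≡ true → Admissible x → Admissible (set x u v true)
  set-true-admissible {x} {u} {v} Auv adm .F⊆x r c Frc = set-true x u v r c (F⊆x adm r c Frc)
  set-true-admissible {x} {u} {v} Auv adm .x⊆A r c x′rc with r Fin.≟ u | c Fin.≟ v
  ... | yes refl | yes refl = Auv
  ... | yes _    | no _     = x⊆A adm r c x′rc
  ... | no _     | _        = x⊆A adm r c x′rc

  set-false-admissible : ∀ {x u v} → F u v ≡ false → Admissible x → Admissible (set x u v false)
  set-false-admissible {x} {u} {v} Fuv adm .F⊆x r c Frc with r Fin.≟ u | c Fin.≟ v
  ... | yes refl | yes refl = contradiction (trans (≡-sym Fuv) Frc) λ ()
  ... | yes _    | no _     = F⊆x adm r c Frc
  ... | no _     | _        = F⊆x adm r c Frc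
  set-false-admissible {x} {u} {v} Fuv adm .x⊆A r c x′rc with r Fin.≟ u | c Fin.≟ v
  ... | yes refl | yes refl = contradiction x′rc λ ()
  ... | yes _    | no _     = x⊆A adm r c x′rc
  ... | no _     | _        = x⊆A adm r c x′rc

  -- One step of an alternating path: u takes over an entry of column v from w.
  Exchange : Matrix n → Fin n → Fin n → Set
  Exchange x u w = ∃[ v ] A u v ≡ true × x u v ≡ false × x w v ≡ true × F w v ≡ false

  exchange? : ∀ x → B.Decidable (Exchange x)
  exchange? x u w = Fin.any? λ v →
    (A u v ≟ᵇ true) ×-dec (x u v ≟ᵇ false) ×-dec (x w v ≟ᵇ true) ×-dec (F w v ≟ᵇ false)

  -- The first row of a path only receives an entry, so keeping its zeros is enough; later rows also
  -- give one up and must agree entirely.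
  transport-path : ∀ {x y z w ws} → (∀ c → x w c ≡ false → y w c ≡ false) →
    All (λ r → ∀ c → y r c ≡ x r c) ws →
    SimplePath (Exchange x) z w ws → SimplePath (Exchange y) z w ws
  transport-path head-ok [] [] = []
  transport-path head-ok (same ∷ sames) (step (v , Awv , xwv , xw′v , Fw′v) fresh path) =
    step (v , Awv , head-ok v xwv , trans (same v) xw′v , Fw′v) fresh
      (transport-path (λ c → trans (same c)) sames path)

  end-fresh : ∀ {x z u w ws} → All (u ≢_) (w ∷ ws) → SimplePath (Exchange x) z w ws → z ≢ u
  end-fresh (u≢w ∷ _)   []              = u≢w ∘ ≡-sym
  end-fresh (_ ∷ fresh) (step _ _ path) = end-fresh fresh path

  -- One unit moves from row `z` to row `u`. The field `end-row` keeps the zeros of row `z`, so that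
  -- a free entry there can still be filled afterwards.
  record Shifted (x : Matrix n) (u z : Fin n) : Set where
    field
      matrix     : Matrix n
      admissible : Admissible matrix
      rows       : ∀ r → row matrix r + δ r z ≡ row x r + δ r u
      cols       : ∀ c → row (flip matrix) c ≡ row (flip x) c
      end-row    : ∀ c → x z c ≡ false → matrix z c ≡ false

  -- The first exchange alters rows u and w only, so a simple path stays valid after it.
  shift : ∀ {x z u ws} → Admissible x → SimplePath (Exchange x) z u ws → Shifted x u z
  shift {x} adm [] = record
    { matrix = x ; admissible = adm ; rows = λ _ → refl ; cols = λ _ → refl ; end-row = λ _ → id }
  shift {x} {z} {u} {w ∷ ws} adm (step (v , Auv , xuv , xwv , Fwv) (u≢w ∷ fresh) path) = record
    { matrix     = matrix
    ; admissible = admissible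
    ; rows       = rows′
    -- Column `v` gains the entry in row `u` and loses the one in row `w`.
    ; cols       = λ c → trans (cols c) (+-cancelʳ-≡ (δ c v) _ _ (trans (≡-sym (cols₂ c)) (cols₁ c)))
    ; end-row    = λ c → end-row c ∘ end-row₂ c
    }
    where
    x₁ x₂ : Matrix n
    x₁ = set x u v true
    x₂ = set x₁ w v false
    x₁w : ∀ c → x₁ w c ≡ x w c
    x₁w = set-row x v true (u≢w ∘ ≡-sym)
    ext₁ : Extends u v x x₁
    ext₁ = set-true-extends x u v xuv
    ext₂ : Extends w v x₂ x₁
    ext₂ = set-false-extends x₁ w v (trans (x₁w v) xwv)
    cols₁ : ∀ c → row (flip x₁) c ≡ row (flip x) c + δ c v
    cols₁ = row-extends {y = flip x₁} (flip-extends {x = x} {x₁} ext₁)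
    cols₂ : ∀ c → row (flip x₁) c ≡ row (flip x₂) c + δ c v
    cols₂ = row-extends {y = flip x₁} (flip-extends {x = x₂} {x₁} ext₂)
    x₂w : ∀ c → x w c ≡ false → x₂ w c ≡ false
    x₂w c xwc = set-false x₁ w v w c (trans (x₁w c) xwc)
    untouched : ∀ {r} → r ≢ u → r ≢ w → ∀ c → x₂ r c ≡ x r c
    untouched r≢u r≢w c = trans (set-row x₁ v false r≢w c) (set-row x v true r≢u c)
    off-path : ∀ {ws} → All (u ≢_) ws → All (w ≢_) ws → All (λ r → ∀ c → x₂ r c ≡ x r c) ws
    off-path []        []        = []
    off-path (p ∷ ps) (q ∷ qs) = untouched (p ∘ ≡-sym) (q ∘ ≡-sym) ∷ off-path ps qs
    w-fresh : ∀ {w z ws} → SimplePath (Exchange x) z w ws → All (w ≢_) ws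
    w-fresh []             = []
    w-fresh (step _ fr _) = fr
    end-row₂ : ∀ c → x z c ≡ false → x₂ z c ≡ false
    end-row₂ c xzc = split (z Fin.≟ w)
      where
      split : Dec (z ≡ w) → x₂ z c ≡ false
      split (yes refl) = x₂w c xzc
      split (no z≢w)   = trans (untouched (end-fresh (u≢w ∷ fresh) path) z≢w c) xzc
    open Shifted (shift (set-false-admissible Fwv (set-true-admissible Auv adm))
                        (transport-path x₂w (off-path fresh (w-fresh path)) path))
    rows′ : ∀ r → row matrix r + δ r z ≡ row x r + δ r u
    rows′ r = begin
      row matrix r + δ r z  ≡⟨ rows r ⟩
      row x₂ r + δ r w      ≡⟨ row-extends {y = x₁} ext₂ r ⟨
      row x₁ r              ≡⟨ row-extends {y = x₁} ext₁ r ⟩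
      row x r + δ r u       ∎

  -- Partial factors, deficits and violated cuts

  module _ (a b : ℕ) where

    record Partial (x : Matrix n) : Set where
      field
        admissible : Admissible x
        rows≤b     : ∀ r → row x r ≤ b
        cols≤b     : ∀ c → row (flip x) c ≤ b

    flip-partial : ∀ {x} → Partial x → Partial (flip x)
    flip-partial px = record { admissible = flip-admissible admissible ; rows≤b = cols≤b ; cols≤b = rows≤b }
      where open Partial px

    Factor : Matrix n → Set
    Factor x = Partial x × (∀ r → a ≤ row x r) × (∀ c → a ≤ row (flip x) c)

    -- Such a cut excludes a factor: rows `T` need `a |T|` entries, but columns `S` hold at most
    -- `b |S|`, part of it taken by forced entries in rows outside `T`, and outside `S` only allowed
    -- entries of `A` are available.
    Violator : Set
    Violator = Σ (Subset n) λ T → Σ (Subset n) λ S →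
      b * ∣ S ∣ + between T (∁ S) A + 1 ≤ a * ∣ T ∣ + between (∁ T) S F

    deficit : Matrix n → ℕ
    deficit x = sum (λ r → a ∸ row x r)

    total-deficit : Matrix n → ℕ
    total-deficit x = deficit x + deficit (flip x)

    Improvement : Matrix n → Set
    Improvement x = ∃[ y ] Partial y × total-deficit y < total-deficit x

    ∸-≤ : ∀ {k m} → a ≤ m ⊎ k ≤ m → a ∸ m ≤ a ∸ k
    ∸-≤ (inj₁ a≤m) = ≤-trans (≤-reflexive (m≤n⇒m∸n≡0 a≤m)) z≤n
    ∸-≤ (inj₂ k≤m) = ∸-monoʳ-≤ a k≤m

    deficit-≤ : ∀ x y → (∀ r → row x r ≤ row y r) → deficit y ≤ deficit x
    deficit-≤ x y x≤y = sum-mono-≤ {n} (λ r → ∸-monoʳ-≤ a (x≤y r))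

    -- A row may shrink if it keeps `a` entries, since its deficit is then 0.
    deficit-< : ∀ x y {u} → (∀ r → a ≤ row y r ⊎ row x r ≤ row y r) →
      row x u < a → row y u ≡ row x u + 1 → deficit y < deficit x
    deficit-< x y {u} no-worse xu<a yu≡ = sum-mono-< {n} (λ r → ∸-≤ (no-worse r)) u
      (∸-monoʳ-< (≤-reflexive (≡-sym yu≡suc)) (≤-trans (≤-reflexive yu≡suc) xu<a))
      where
      yu≡suc : row y u ≡ suc (row x u)
      yu≡suc = trans yu≡ (+-comm _ 1)

    raise-≤ : ∀ {k m : Fin n → ℕ} {u} → (∀ r → k r ≤ m r + δ r u) → m u < b → (∀ r → m r ≤ b) → ∀ r → k r ≤ b
    raise-≤ {k} {m} {u} k≤ mu<b m≤b r with r Fin.≟ u | k≤ r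
    ... | yes refl | kr≤ = ≤-trans kr≤ (≤-trans (≤-reflexive (+-comm (m r) 1)) mu<b)
    ... | no _     | kr≤ = ≤-trans kr≤ (≤-trans (≤-reflexive (+-identityʳ (m r))) (m≤b r))

    -- Row `z` can spare the unit given to `u`, and the column sums do not move.
    take-from-row : ∀ {x u z} → a ≤ b → Partial x → row x u < a → a < row x z → Shifted x u z → Improvement x
    take-from-row {x} {u} {z} a≤b px xu<a a<xz sh = matrix ,
      record
        { admissible = admissible
        ; rows≤b     = raise-≤ (λ r → ≤-trans (m≤m+n _ _) (≤-reflexive (rows r))) (<-≤-trans xu<a a≤b) rows≤b
        ; cols≤b     = λ c → ≤-trans (≤-reflexive (cols c)) (cols≤b c)
        } ,
      +-mono-<-≤ (deficit-< x matrix no-worse xu<a row-u)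
        (deficit-≤ (flip x) (flip matrix) (λ c → ≤-reflexive (≡-sym (cols c))))
      where
      open Partial px using (rows≤b; cols≤b)
      open Shifted sh
      u≢z : u ≢ z
      u≢z refl = <-asym xu<a a<xz
      row-u : row matrix u ≡ row x u + 1
      row-u = begin
        row matrix u          ≡⟨ +-identityʳ _ ⟨
        row matrix u + 0      ≡⟨ cong (row matrix u +_) (δ-≢ u≢z) ⟨
        row matrix u + δ u z  ≡⟨ rows u ⟩
        row x u + δ u u       ≡⟨ cong (row x u +_) (δ-refl u) ⟩
        row x u + 1           ∎
      no-worse : ∀ r → a ≤ row matrix r ⊎ row x r ≤ row matrix r
      no-worse r with r Fin.≟ z | rows r
      ... | yes refl | eq = inj₁ (s≤s⁻¹ (≤-trans a<xz (≤-trans (m≤m+n _ _)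
                                   (≤-reflexive (trans (≡-sym eq) (+-comm _ 1))))))
      ... | no _     | eq = inj₂ (≤-trans (m≤m+n _ _) (≤-reflexive (trans (≡-sym eq) (+-identityʳ _))))

    -- The free entry at `(z , v)` repays the unit shifted out of row `z`; in total row `u` and
    -- column `v` gain one.
    fill-column : ∀ {x u z v} → a ≤ b → Partial x → row x u < a → A z v ≡ true → x z v ≡ false →
      row (flip x) v < b → Shifted x u z → Improvement x
    fill-column {x} {u} {z} {v} a≤b px xu<a Azv xzv xv<b sh = y ,
      record
        { admissible = set-true-admissible Azv admissible
        ; rows≤b     = raise-≤ (≤-reflexive ∘ rows-y) (<-≤-trans xu<a a≤b) rows≤b
        ; cols≤b     = raise-≤ (≤-reflexive ∘ cols-y) xv<b cols≤b
        } ,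
      +-mono-<-≤
        (deficit-< x y (λ r → inj₂ (≤-trans (m≤m+n _ _) (≤-reflexive (≡-sym (rows-y r))))) xu<a
          (trans (rows-y u) (cong (row x u +_) (δ-refl u))))
        (deficit-≤ (flip x) (flip y) (λ c → ≤-trans (m≤m+n _ _) (≤-reflexive (≡-sym (cols-y c)))))
      where
      open Partial px using (rows≤b; cols≤b)
      open Shifted sh
      y : Matrix n
      y = set matrix z v true
      ext : Extends z v matrix y
      ext = set-true-extends matrix z v (end-row v xzv)
      rows-y : ∀ r → row y r ≡ row x r + δ r u
      rows-y r = trans (row-extends {y = y} ext r) (rows r)
      cols-y : ∀ c → row (flip y) c ≡ row (flip x) c + δ c v
      cols-y c = trans (row-extends {y = flip y} (flip-extends {x = matrix} {y} ext) c) (cong (_+ δ c v) (cols c))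

    Augmentable : Matrix n → Fin n → Set
    Augmentable x z = a < row x z ⊎ ∃[ v ] A z v ≡ true × x z v ≡ false × row (flip x) v < b

    augmentable? : ∀ x → Decidable (Augmentable x)
    augmentable? x z = (a <? row x z) ⊎-dec
      Fin.any? λ v → (A z v ≟ᵇ true) ×-dec (x z v ≟ᵇ false) ×-dec (row (flip x) v <? b)

    -- No row of `T` has more than `a` entries and row `u` has fewer. A column in which some row of
    -- `T` has a free allowed entry belongs to `S` and is full. Comparing the entries of `x` in the
    -- rows `T` with those in the columns `S` gives the cut.
    closed⇒violator : ∀ {x u} → Partial x → row x u < a →
      Closed (Exchange x) (exchange? x) (augmentable? x) u → Violator
    closed⇒violator {x} {u} px xu<a (T , Tu , not-augmentable , closed) = T , S , violated
      where
      open Partial px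
      open Admissible admissible

      Escapes : Fin n → Fin n → Set
      Escapes v w = T w ≡ true × A w v ≡ true × x w v ≡ false
      escapes? : ∀ v → Dec (∃[ w ] Escapes v w)
      escapes? v = Fin.any? λ w → (T w ≟ᵇ true) ×-dec (A w v ≟ᵇ true) ×-dec (x w v ≟ᵇ false)
      S : Subset n
      S v = does (escapes? v)

      T-rows : sum (λ r → ι (T r) * row x r) < a * ∣ T ∣
      T-rows = <-≤-trans (sum-mono-< le u lt) (≤-reflexive (≡-sym (*-distribˡ-sum a (ι ∘ T))))
        where
        le : ∀ r → ι (T r) * row x r ≤ a * ι (T r)
        le r with T r in Tr
        ... | false = z≤n
        ... | true  = ≤-trans (≤-reflexive (*-identityˡ _))
                        (≤-trans (≮⇒≥ (not-augmentable r Tr ∘ inj₁)) (≤-reflexive (≡-sym (*-identityʳ a))))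
        lt : ι (T u) * row x u < a * ι (T u)
        lt rewrite Tu = subst₂ _<_ (≡-sym (*-identityˡ _)) (≡-sym (*-identityʳ a)) xu<a

      S-cols : b * ∣ S ∣ ≤ sum (λ v → ι (S v) * row (flip x) v)
      S-cols = ≤-trans (≤-reflexive (*-distribˡ-sum b (ι ∘ S))) (sum-mono-≤ le)
        where
        le : ∀ v → b * ι (S v) ≤ ι (S v) * row (flip x) v
        le v with escapes? v
        ... | no _ = ≤-reflexive (*-zeroʳ b)
        ... | yes (w , Tw , Awv , xwv) = subst₂ _≤_ (≡-sym (*-identityʳ b)) (≡-sym (*-identityˡ _))
          (≮⇒≥ λ xv<b → not-augmentable w Tw (inj₂ (v , Awv , xwv , xv<b)))

      -- An entry of `x` in a column of `S` and a row outside `T` must be forced, as otherwise an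
      -- exchange would bring its row into `T`. In rows of `T`, every allowed entry outside `S` is
      -- already occupied.
      entry : ∀ r c → ι (S c) * ι (x r c) + ι (T r ∧ ∁ S c ∧ A r c) ≤ ι (T r) * ι (x r c) + ι (∁ T r ∧ S c ∧ F r c)
      entry r c with escapes? c | T r in Tr | x r c in xrc
      ... | yes _  | true  | _     = +-monoʳ-≤ _ z≤n
      ... | yes _  | false | false = z≤n
      ... | yes (w , Tw , Awc , xwc) | false | true with F r c in Frc
      ...   | true  = ≤-refl
      ...   | false = contradiction (trans (≡-sym Tr) (closed (c , Awc , xwc , xrc , Frc) Tw)) λ ()
      entry r c | no _   | false | _     = z≤n
      entry r c | no _   | true  | true  with A r c
      ...   | true  = ≤-refl
      ...   | false = z≤n
      entry r c | no ¬e  | true  | false with A r c in Arc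
      ...   | true  = contradiction (r , Tr , Arc , xrc) ¬e
      ...   | false = z≤n

      double-count : sum (λ v → ι (S v) * row (flip x) v) + between T (∁ S) A ≤
        sum (λ r → ι (T r) * row x r) + between (∁ T) S F
      double-count = subst₂ _≤_ left right (sum-mono-≤ (λ r → sum-mono-≤ (entry r)))
        where
        split : ∀ (f g : Fin n → Fin n → ℕ) →
          sum (λ r → sum (λ c → f r c + g r c)) ≡ sum (λ r → sum (f r)) + sum (λ r → sum (g r))
        split f g = trans (sum-cong-≗ (λ r → ∑-distrib-+ (f r) (g r))) (∑-distrib-+ (λ r → sum (f r)) _)
        left : sum (λ r → sum (λ c → ι (S c) * ι (x r c) + ι (T r ∧ ∁ S c ∧ A r c))) ≡
          sum (λ v → ι (S v) * row (flip x) v) + between T (∁ S) A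
        left = trans (split (λ r c → ι (S c) * ι (x r c)) _) (cong (_+ between T (∁ S) A)
          (trans (∑-comm (λ r c → ι (S c) * ι (x r c)))
            (sum-cong-≗ (λ c → ≡-sym (*-distribˡ-sum (ι (S c)) (λ r → ι (x r c)))))))
        right : sum (λ r → sum (λ c → ι (T r) * ι (x r c) + ι (∁ T r ∧ S c ∧ F r c))) ≡
          sum (λ r → ι (T r) * row x r) + between (∁ T) S F
        right = trans (split (λ r c → ι (T r) * ι (x r c)) _) (cong (_+ between (∁ T) S F)
          (sum-cong-≗ (λ r → ≡-sym (*-distribˡ-sum (ι (T r)) (λ c → ι (x r c))))))

      violated : b * ∣ S ∣ + between T (∁ S) A + 1 ≤ a * ∣ T ∣ + between (∁ T) S F
      violated = ≤-trans (≤-reflexive (+-comm _ 1))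
        (≤-<-trans (≤-trans (+-monoˡ-≤ _ S-cols) double-count) (+-monoˡ-< _ T-rows))

    improve : ∀ {x u} → a ≤ b → Partial x → row x u < a → Improvement x ⊎ Violator
    improve {x} {u} a≤b px xu<a with reached-or-closed (Exchange x) (exchange? x) (augmentable? x) u
    ... | inj₂ closed = inj₂ (closed⇒violator px xu<a closed)
    ... | inj₁ (z , inj₁ a<xz , _ , path) = inj₁ (take-from-row a≤b px xu<a a<xz (shift (Partial.admissible px) path))
    ... | inj₁ (z , inj₂ (v , Azv , xzv , xv<b) , _ , path) =
      inj₁ (fill-column a≤b px xu<a Azv xzv xv<b (shift (Partial.admissible px) path))

    factor-or-violator : ∀ {x} → a ≤ b → Partial x → ∃ Factor ⊎ Violator
    factor-or-violator {x} a≤b px = loop (suc (total-deficit x)) px ≤-refl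
      where
      loop : ∀ k {x} → Partial x → total-deficit x < k → ∃ Factor ⊎ Violator
      loop (suc k) {x} px (s≤s ≤k) with Fin.any? (λ r → row x r <? a)
      ... | yes (u , xu<a) with improve a≤b px xu<a
      ...   | inj₁ (y , py , less) = loop k py (≤-trans less ≤k)
      ...   | inj₂ violator        = inj₂ violator
      loop (suc k) {x} px (s≤s ≤k) | no rows-ok with Fin.any? (λ c → row (flip x) c <? a)
      ... | no cols-ok = inj₁ (x , px , (λ r → ≮⇒≥ (rows-ok ∘ (r ,_))) , (λ c → ≮⇒≥ (cols-ok ∘ (c ,_))))
      -- A deficient column is a deficient row of the transpose. The loop goes on with the
      -- transposed matrix, as all requirements are symmetric in rows and columns.
      ... | yes (v , xv<a) with improve a≤b (flip-partial px) xv<a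
      ...   | inj₁ (y , py , less) =
        loop k py (≤-trans less (≤-trans (≤-reflexive (+-comm (deficit (flip x)) (deficit x))) ≤k))
      ...   | inj₂ violator        = inj₂ violator

-- Counting edges

between-comm : (T S : Subset n) {M : Matrix n} → (∀ i j → M i j ≡ M j i) → between T S M ≡ between S T M
between-comm T S {M} M-sym = trans (∑-comm (λ u v → ι (T u ∧ S v ∧ M u v)))
  (sum-cong-≗ λ v → sum-cong-≗ λ u → cong ι (swap (T u) (S v) (M-sym u v)))
  where
  swap : ∀ p q {r s} → r ≡ s → p ∧ q ∧ r ≡ q ∧ p ∧ s
  swap true  true  refl = refl
  swap true  false refl = refl
  swap false true  refl = refl
  swap false false refl = refl

between-∁∁ : (T S : Subset n) (M : Matrix n) → between (∁ (∁ T)) S M ≡ between T S M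
between-∁∁ T S M = sum-cong-≗ λ u → sum-cong-≗ λ v → cong (λ p → ι (p ∧ S v ∧ M u v)) (not-involutive (T u))

between-empty : (T S : Subset n) (M : Matrix n) → ∣ S ∣ ≡ 0 → between T S M ≡ 0
between-empty {n} T S M ∣S∣≡0 = trans (sum-cong-≗ λ u → trans (sum-cong-≗ (zero-entry u)) (sum-zero n)) (sum-zero n)
  where
  zero-entry : ∀ u v → ι (T u ∧ S v ∧ M u v) ≡ 0
  zero-entry u v rewrite ∣T∣≡0⇒empty S ∣S∣≡0 v with T u
  ... | true  = refl
  ... | false = refl

sum² : (Fin n → Fin n → ℕ) → ℕ
sum² f = sum (λ i → sum (f i))

sum²-mono-≤ : {f g : Fin n → Fin n → ℕ} → (∀ i j → f i j ≤ g i j) → sum² f ≤ sum² g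
sum²-mono-≤ f≤g = sum-mono-≤ λ i → sum-mono-≤ (f≤g i)

sum²-distrib-+ : (f g : Fin n → Fin n → ℕ) → sum² (λ i j → f i j + g i j) ≡ sum² f + sum² g
sum²-distrib-+ f g = trans (sum-cong-≗ λ i → ∑-distrib-+ (f i) (g i)) (∑-distrib-+ (λ i → sum (f i)) _)

sum²-product : (f g : Fin n → ℕ) → sum² (λ i j → f i * g j) ≡ sum f * sum g
sum²-product f g = trans (sum-cong-≗ λ i → ≡-sym (*-distribˡ-sum (f i) g)) (≡-sym (*-distribʳ-sum (sum g) f))

length-filterᵇ-tabulate : ∀ {A : Set} (p : A → Bool) (f : Fin n → A) →
  length (filterᵇ p (tabulate f)) ≡ sum (λ i → ι (p (f i)))
length-filterᵇ-tabulate {zero}  p f = refl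
length-filterᵇ-tabulate {suc n} p f with p (f zero)
... | true  = cong suc (length-filterᵇ-tabulate p (f ∘ suc))
... | false = length-filterᵇ-tabulate p (f ∘ suc)

length-concatMap-tabulate : ∀ {A B : Set} (g : A → List B) (f : Fin n → A) →
  length (concatMap g (tabulate f)) ≡ sum (λ i → length (g (f i)))
length-concatMap-tabulate {zero}  g f = refl
length-concatMap-tabulate {suc n} g f = trans (length-++ (g (f zero)))
  (cong (length (g (f zero)) +_) (length-concatMap-tabulate g (f ∘ suc)))

module _ (G : Graph n) where

  degree≡row : ∀ u → degree G u ≡ row (adj G) u
  degree≡row u = length-filterᵇ-tabulate (adj G u) id

  private
    upper : Matrix n
    upper i j = (toℕ i <ᵇ toℕ j) ∧ adj G i j

    upper+lower : ∀ i j → ι (upper i j) + ι (upper j i) ≡ ι (adj G i j)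
    upper+lower i j with toℕ i <ᵇ toℕ j in i<j | toℕ j <ᵇ toℕ i in j<i
    ... | true  | true  = contradiction (<ᵇ⇒< (toℕ j) _ (subst T (≡-sym j<i) tt))
                            (<-asym (<ᵇ⇒< (toℕ i) _ (subst T (≡-sym i<j) tt)))
    ... | true  | false = +-identityʳ _
    ... | false | true  = cong ι (sym G j i)
    ... | false | false = ≡-sym (trans (cong (λ k → ι (adj G i k)) (≡-sym i≡j)) (cong ι (irrefl G i)))
      where
      i≡j : i ≡ j
      i≡j = Fin.toℕ-injective (≤-antisym (≮⇒≥ λ lt → subst T j<i (<⇒<ᵇ {toℕ j} lt))
                                          (≮⇒≥ λ lt → subst T i<j (<⇒<ᵇ {toℕ i} lt)))

  handshake : 2 * numEdges G ≡ sum² (λ i j → ι (adj G i j))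
  handshake = begin
    2 * numEdges G                                      ≡⟨ cong (numEdges G +_) (+-identityʳ _) ⟩
    numEdges G + numEdges G                             ≡⟨ cong₂ _+_ edges edges ⟩
    sum² (λ i j → ι (upper i j)) + sum² (λ i j → ι (upper i j))
      ≡⟨ cong (sum² (λ i j → ι (upper i j)) +_) (∑-comm (λ i j → ι (upper i j))) ⟩
    sum² (λ i j → ι (upper i j)) + sum² (λ i j → ι (upper j i))
      ≡⟨ sum²-distrib-+ (λ i j → ι (upper i j)) (λ i j → ι (upper j i)) ⟨
    sum² (λ i j → ι (upper i j) + ι (upper j i))
      ≡⟨ sum-cong-≗ (λ i → sum-cong-≗ (upper+lower i)) ⟩
    sum² (λ i j → ι (adj G i j))                        ∎
    where
    edges : numEdges G ≡ sum² (λ i j → ι (upper i j))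
    edges = trans (length-concatMap-tabulate (λ i → filterᵇ (upper i) (allFin n)) id)
      (sum-cong-≗ λ i → length-filterᵇ-tabulate (upper i) id)

  -- Twice the bound `C(m , 2) + ts + e(T , V∖S)`, with the diagonal of `∁ T` moved to the left to
  -- avoid subtraction. An adjacent pair meeting `T` is charged from an end in `T`: to `T × S` if
  -- the other end is in `S`, and to `between T (∁ S)` if not.
  edges-≤ : (T S : Subset n) →
    2 * numEdges G + ∣ ∁ T ∣ ≤ ∣ ∁ T ∣ * ∣ ∁ T ∣ + 2 * (∣ T ∣ * ∣ S ∣ + between T (∁ S) (adj G))
  edges-≤ T S = subst₂ _≤_ left right (sum²-mono-≤ entry)
    where
    half : Fin n → Fin n → ℕ
    half u v = ι (T u) * ι (S v) + ι (T u ∧ ∁ S v ∧ adj G u v)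

    entry : ∀ u v → ι (adj G u v) + ι (∁ T u) * δ v u ≤ ι (∁ T u) * ι (∁ T v) + (half u v + half v u)
    entry u v with T u in Tu | T v in Tv
    ... | true  | _ = ≤-trans (≤-reflexive (+-identityʳ _)) (≤-trans (bound (S v) (adj G u v)) (m≤m+n _ _))
      where
      bound : ∀ p q → ι q ≤ ι p + 0 + ι (not p ∧ q)
      bound true  true  = ≤-refl
      bound true  false = z≤n
      bound false q     = ≤-refl
    ... | false | true rewrite sym G u v with v Fin.≟ u
    ...   | yes refl = contradiction (trans (≡-sym Tu) Tv) λ ()
    ...   | no _     = bound (S u) (adj G v u)
      where
      bound : ∀ p q → ι q + 0 ≤ ι p + 0 + ι (not p ∧ q)
      bound true  true  = ≤-refl
      bound true  false = z≤n
      bound false true  = ≤-refl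
      bound false false = ≤-refl
    entry u v | false | false with v Fin.≟ u
    ...   | yes refl rewrite irrefl G v = ≤-refl
    ...   | no _ with adj G u v
    ...     | true  = ≤-refl
    ...     | false = z≤n

    left : sum² (λ u v → ι (adj G u v) + ι (∁ T u) * δ v u) ≡ 2 * numEdges G + ∣ ∁ T ∣
    left = trans (sum²-distrib-+ (λ u v → ι (adj G u v)) _) (cong₂ _+_ (≡-sym handshake) (sum-cong-≗ diagonal))
      where
      diagonal : ∀ u → sum (λ v → ι (∁ T u) * δ v u) ≡ ι (∁ T u)
      diagonal u = trans (≡-sym (*-distribˡ-sum (ι (∁ T u)) (λ v → δ v u)))
        (trans (cong (ι (∁ T u) *_) (sum-δ u)) (*-identityʳ _))

    half-sum : sum² half ≡ ∣ T ∣ * ∣ S ∣ + between T (∁ S) (adj G)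
    half-sum = trans (sum²-distrib-+ (λ u v → ι (T u) * ι (S v)) _)
      (cong (_+ between T (∁ S) (adj G)) (sum²-product (ι ∘ T) (ι ∘ S)))

    right : sum² (λ u v → ι (∁ T u) * ι (∁ T v) + (half u v + half v u)) ≡
      ∣ ∁ T ∣ * ∣ ∁ T ∣ + 2 * (∣ T ∣ * ∣ S ∣ + between T (∁ S) (adj G))
    right = begin
      sum² (λ u v → ι (∁ T u) * ι (∁ T v) + (half u v + half v u))
        ≡⟨ sum²-distrib-+ (λ u v → ι (∁ T u) * ι (∁ T v)) _ ⟩
      sum² (λ u v → ι (∁ T u) * ι (∁ T v)) + sum² (λ u v → half u v + half v u)
        ≡⟨ cong₂ _+_ (sum²-product (ι ∘ ∁ T) (ι ∘ ∁ T)) (sum²-distrib-+ half (flip half)) ⟩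
      ∣ ∁ T ∣ * ∣ ∁ T ∣ + (sum² half + sum² (flip half))
        ≡⟨ cong (λ k → ∣ ∁ T ∣ * ∣ ∁ T ∣ + (sum² half + k)) (trans (∑-comm (flip half)) (≡-sym (+-identityʳ _))) ⟩
      ∣ ∁ T ∣ * ∣ ∁ T ∣ + 2 * sum² half
        ≡⟨ cong (λ k → ∣ ∁ T ∣ * ∣ ∁ T ∣ + 2 * k) half-sum ⟩
      ∣ ∁ T ∣ * ∣ ∁ T ∣ + 2 * (∣ T ∣ * ∣ S ∣ + between T (∁ S) (adj G))  ∎

  -- Summing degrees over `T`: each vertex has at most `|S|` neighbours in `S`, and the others are
  -- counted by `between`.
  degrees-≤ : ∀ {d} → minDegree≥ G d → (T S : Subset n) →
    d * ∣ T ∣ ≤ between T (∁ S) (adj G) + ∣ S ∣ * ∣ T ∣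
  degrees-≤ {d} δ≥d T S = ≤-trans left (≤-trans (sum²-mono-≤ entry) (≤-reflexive
    (trans (sum²-distrib-+ (λ u v → ι (T u ∧ ∁ S v ∧ adj G u v)) _)
      (cong (between T (∁ S) (adj G) +_) (trans (sum²-product (ι ∘ T) (ι ∘ S)) (*-comm ∣ T ∣ ∣ S ∣))))))
    where
    entry : ∀ u v → ι (T u) * ι (adj G u v) ≤ ι (T u ∧ ∁ S v ∧ adj G u v) + ι (T u) * ι (S v)
    entry u v with T u | S v | adj G u v
    ... | false | _     | _     = z≤n
    ... | true  | true  | true  = ≤-refl
    ... | true  | true  | false = z≤n
    ... | true  | false | true  = ≤-refl
    ... | true  | false | false = z≤n
    left : d * ∣ T ∣ ≤ sum² (λ u v → ι (T u) * ι (adj G u v))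
    left = ≤-trans (≤-reflexive (trans (*-comm d ∣ T ∣) (*-distribʳ-sum d (ι ∘ T)))) (sum-mono-≤ λ u →
      ≤-trans (*-monoʳ-≤ (ι (T u)) (≤-trans (δ≥d u) (≤-reflexive (degree≡row u))))
              (≤-reflexive (*-distribˡ-sum (ι (T u)) (λ v → ι (adj G u v)))))

-- Half-integral weights

halves : ℕ → ℚ
halves k = ℤ.+ k / 2

halves≃ : ∀ k → toℚᵘ (halves k) ℚᵘ.≃ mkℚᵘ (ℤ.+ k) 1
halves≃ k = ℚ.toℚᵘ-fromℚᵘ (mkℚᵘ (ℤ.+ k) 1)

halves-+ : ∀ k m → halves (k + m) ≡ halves k ℚ.+ halves m
halves-+ k m = ℚ.toℚᵘ-injective (ℚᵘ.≃-trans (halves≃ (k + m)) (ℚᵘ.≃-sym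
  (ℚᵘ.≃-trans (ℚ.toℚᵘ-homo-+ (halves k) (halves m))
    (ℚᵘ.≃-trans (ℚᵘ.+-cong (halves≃ k) (halves≃ m)) (*≡* (cross (ℤ.+ k) (ℤ.+ m)))))))
  where
  -- Cross-multiplied form of `(2p + 2q) / 4 = (p + q) / 2`.
  cross : ∀ (p q : ℤ) → (p ℤ.* ℤ.+ 2 ℤ.+ q ℤ.* ℤ.+ 2) ℤ.* ℤ.+ 2 ≡ (p ℤ.+ q) ℤ.* ℤ.+ 4
  cross = solveℤ-∀

halves-mono : ∀ {k m} → k ≤ m → halves k ℚ.≤ halves m
halves-mono {k} {m} k≤m = ℚ.toℚᵘ-cancel-≤ (ℚᵘ.≤-respʳ-≃ (ℚᵘ.≃-sym (halves≃ m)) (ℚᵘ.≤-respˡ-≃ (ℚᵘ.≃-sym (halves≃ k))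
  (*≤* (ℤ.*-monoʳ-≤-nonNeg (ℤ.+ 2) (ℤ.+≤+ k≤m)))))

halves-double : ∀ k → halves (2 * k) ≡ ℕ→ℚ k
halves-double k = ℚ.fromℚᵘ-cong {mkℚᵘ (ℤ.+ (2 * k)) 1} {mkℚᵘ (ℤ.+ k) 0}
  (*≡* (trans (ℤ.*-identityʳ _) (trans (ℤ.pos-* 2 k) (ℤ.*-comm (ℤ.+ 2) (ℤ.+ k)))))

sumℚ-halves : ∀ {A : Set} (c : A → ℕ) (p : A → Bool) (f : Fin n → A) →
  sumℚ (map (halves ∘ c) (filterᵇ p (tabulate f))) ≡ halves (sum (λ i → ι (p (f i)) * c (f i)))
sumℚ-halves {zero}  c p f = refl
sumℚ-halves {suc n} c p f with p (f zero)
... | true  = begin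
  halves (c (f zero)) ℚ.+ sumℚ (map (halves ∘ c) (filterᵇ p (tabulate (f ∘ suc))))
    ≡⟨ cong (halves (c (f zero)) ℚ.+_) (sumℚ-halves c p (f ∘ suc)) ⟩
  halves (c (f zero)) ℚ.+ halves rest  ≡⟨ halves-+ (c (f zero)) rest ⟨
  halves (c (f zero) + rest)           ≡⟨ cong (λ k → halves (k + rest)) (+-identityʳ (c (f zero))) ⟨
  halves (1 * c (f zero) + rest)       ∎
  where
  rest : ℕ
  rest = sum (λ i → ι (p (f (suc i))) * c (f (suc i)))
... | false = sumℚ-halves c p (f ∘ suc)

-- Factors through a single edge

-- Both orientations are forced, so that averaging with the transpose gives the edge weight exactly
-- 1.
singleEdge : Fin n → Fin n → Matrix n
singleEdge i j r c = (does (r Fin.≟ i) ∧ does (c Fin.≟ j)) ∨ (does (r Fin.≟ j) ∧ does (c Fin.≟ i))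

module _ (i j : Fin n) where

  singleEdge-sym : ∀ r c → singleEdge i j r c ≡ singleEdge i j c r
  singleEdge-sym r c = trans (∨-comm (does (r Fin.≟ i) ∧ does (c Fin.≟ j)) _)
    (cong₂ _∨_ (∧-comm (does (r Fin.≟ j)) _) (∧-comm (does (r Fin.≟ i)) _))

  singleEdge-here : singleEdge i j i j ≡ true
  singleEdge-here rewrite dec-true (i Fin.≟ i) refl | dec-true (j Fin.≟ j) refl = refl

  singleEdge⊆ : (G : Graph n) → adj G i j ≡ true → ∀ r c → singleEdge i j r c ≡ true → adj G r c ≡ true
  singleEdge⊆ G Gij r c Frc with r Fin.≟ i | c Fin.≟ j | r Fin.≟ j | c Fin.≟ i
  ... | yes refl | yes refl | _        | _        = Gij
  ... | _        | _        | yes refl | yes refl = trans (sym G r c) Gij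

  singleEdge-≤ : ∀ r c → ι (singleEdge i j r c) ≤ δ r i * δ c j + δ r j * δ c i
  singleEdge-≤ r c = bound (does (r Fin.≟ i)) (does (c Fin.≟ j)) (does (r Fin.≟ j)) (does (c Fin.≟ i))
    where
    bound : ∀ p q p′ q′ → ι ((p ∧ q) ∨ (p′ ∧ q′)) ≤ ι p * ι q + ι p′ * ι q′
    bound true  true  _     _     = s≤s z≤n
    bound true  false true  true  = ≤-refl
    bound true  false true  false = ≤-refl
    bound true  false false _     = ≤-refl
    bound false _     true  true  = ≤-refl
    bound false _     true  false = ≤-refl
    bound false _     false _     = ≤-refl

  singleEdge-between : (T S : Subset n) → between T S (singleEdge i j) ≤ 2
  singleEdge-between T S = ≤-trans (sum²-mono-≤ λ r c → ≤-trans (drop (T r) (S c) _) (singleEdge-≤ r c))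
    (≤-reflexive (trans (sum²-distrib-+ (λ r c → δ r i * δ c j) _) (cong₂ _+_ (one i j) (one j i))))
    where
    drop : ∀ p q r → ι (p ∧ q ∧ r) ≤ ι r
    drop true  true  r = ≤-refl
    drop true  false r = z≤n
    drop false q     r = z≤n
    one : ∀ i j → sum² (λ r c → δ r i * δ c j) ≡ 1
    one i j = trans (sum²-product (λ r → δ r i) (λ c → δ c j)) (cong₂ _*_ (sum-δ i) (sum-δ j))

  singleEdge-row : ∀ r → row (singleEdge i j) r ≤ 2
  singleEdge-row r = ≤-trans (fᵢ≤sum (row (singleEdge i j)) r) (singleEdge-between (λ _ → true) (λ _ → true))

module ForcedEdge (G : Graph n) (i j : Fin n) where

  F : Matrix n
  F = singleEdge i j

  open Augmentation (adj G) F (sym G) (singleEdge-sym i j) public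

  -- Averaging `x` with its transpose symmetrises the weights. Each vertex sum is the mean of a row
  -- sum and a column sum, hence still between `a` and `b`.
  factor⇒fractional : ∀ {a b} → ∃ (Factor a b) → Σ (EdgeFun n) λ h → IsFracFactor G a b h × (h i j ≡ 1ℚ)
  factor⇒fractional {a} {b} (x , px , rows≥a , cols≥a) = h , (h-sym , h-bounds , h-sums) , h-ij
    where
    open Partial px
    open Admissible admissible

    weight : Fin n → Fin n → ℕ
    weight u v = ι (x u v) + ι (x v u)
    h : EdgeFun n
    h u v = halves (weight u v)
    h-sym : ∀ u v → h u v ≡ h v u
    h-sym u v = cong halves (+-comm (ι (x u v)) _)
    ι≤1 : ∀ p → ι p ≤ 1
    ι≤1 true  = ≤-refl
    ι≤1 false = z≤n
    h-bounds : ∀ u v → adj G u v ≡ true → (0ℚ ℚ.≤ h u v) × (h u v ℚ.≤ 1ℚ)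
    h-bounds u v _ = halves-mono {0} {weight u v} z≤n , halves-mono {weight u v} {2} (+-mono-≤ (ι≤1 (x u v)) (ι≤1 (x v u)))
    h-ij : h i j ≡ 1ℚ
    h-ij = cong₂ (λ p q → halves (ι p + ι q)) (F⊆x i j Fij) (F⊆x j i (trans (singleEdge-sym i j j i) Fij))
      where
      Fij : F i j ≡ true
      Fij = singleEdge-here i j

    -- `incSum` runs over neighbours only; the remaining terms of the row and column sums vanish
    -- because `x` is supported on edges.
    supported : ∀ u v → ι (adj G u v) * weight u v ≡ weight u v
    supported u v with adj G u v in Guv | x u v in xuv | x v u in xvu
    ... | true  | p     | q     = *-identityˡ _
    ... | false | false | false = refl
    ... | false | true  | _     = contradiction (trans (≡-sym Guv) (x⊆A u v xuv)) λ ()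
    ... | false | false | true  = contradiction (trans (≡-sym Guv) (trans (sym G u v) (x⊆A v u xvu))) λ ()

    incSum≡ : ∀ u → incSum G h u ≡ halves (row x u + row (flip x) u)
    incSum≡ u = trans (sumℚ-halves (weight u) (adj G u) id) (cong halves
      (trans (sum-cong-≗ (supported u)) (∑-distrib-+ (λ v → ι (x u v)) (λ v → ι (x v u)))))

    h-sums : ∀ u → (ℕ→ℚ a ℚ.≤ incSum G h u) × (incSum G h u ℚ.≤ ℕ→ℚ b)
    h-sums u =
      subst₂ ℚ._≤_ (halves-double a) (≡-sym (incSum≡ u))
        (halves-mono (+-mono-≤ (rows≥a u) (≤-trans (≤-reflexive (+-identityʳ a)) (cols≥a u)))) ,
      subst₂ ℚ._≤_ (≡-sym (incSum≡ u)) (halves-double b)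
        (halves-mono (+-mono-≤ (rows≤b u) (≤-trans (cols≤b u) (≤-reflexive (≡-sym (+-identityʳ b))))))

-- Excluding violated cuts

module _ {a b n} (2≤a : 2 ≤ a) (a≤b : a ≤ b) (G : Graph n)
  (large : 8 * a + 5 * b + 22 ≤ 2 * n) (δ≥a+1 : minDegree≥ G (a + 1))
  (many : ((n ∸ b ∸ 1) C 2) + a * b + 2 * a + b + 1 ≤ numEdges G)
  (i j : Fin n) where

  open ForcedEdge G i j

  small-violator-impossible : (T S : Subset n) → ∣ S ∣ + ∣ T ∣ ≤ n →
    ¬ b * ∣ S ∣ + between T (∁ S) (adj G) + 1 ≤ a * ∣ T ∣ + between (∁ T) S F
  small-violator-impossible T S s+t≤n violated = split ∣ S ∣ refl
    where
    k t : ℕ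
    k = between T (∁ S) (adj G)
    t = ∣ T ∣

    split : ∀ s → ∣ S ∣ ≡ s → ⊥
    split (suc s) ∣S∣≡ = violation-impossible 2≤a a≤b (subst (1 ≤_) (≡-sym ∣S∣≡) (s≤s z≤n)) s≤m
      (∣T∣+∣∁T∣≡n T) large defect (degrees-≤ G δ≥a+1 T S) many (edges-≤ G T S)
      where
      s≤m : ∣ S ∣ ≤ ∣ ∁ T ∣
      s≤m = +-cancelʳ-≤ t _ _ (≤-trans s+t≤n (≤-reflexive (trans (≡-sym (∣T∣+∣∁T∣≡n T)) (+-comm t _))))
      -- The forced edge contributes at most 2, one unit of which is absorbed by the strictness of
      -- the violation.
      defect : b * ∣ S ∣ + k ≤ a * t + 1
      defect = +-cancelʳ-≤ 1 _ _ (≤-trans violated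
        (≤-trans (+-monoʳ-≤ (a * t) (singleEdge-between i j (∁ T) S)) (≤-reflexive (≡-sym (+-assoc (a * t) 1 1)))))
    -- Here the forced edge has no end in S, so it does not help.
    split zero ∣S∣≡0 = <⇒≱ k<at (≤-trans (*-monoˡ-≤ t (m≤m+n a 1)) at≤k)
      where
      at≤k : (a + 1) * t ≤ k
      at≤k = ≤-trans (degrees-≤ G δ≥a+1 T S) (≤-reflexive (trans (cong (λ s → k + s * t) ∣S∣≡0) (+-identityʳ k)))
      k<at : k < a * t
      k<at = ≤-trans (≤-reflexive (+-comm 1 k)) (≤-trans (+-monoˡ-≤ 1 (m≤n+m k (b * ∣ S ∣)))
        (≤-trans violated (≤-reflexive (trans (cong (a * t +_) (between-empty (∁ T) S F ∣S∣≡0)) (+-identityʳ _)))))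

  violator-impossible : ¬ Violator a b
  violator-impossible (T , S , violated) with ≤-total (∣ S ∣ + ∣ T ∣) n
  ... | inj₁ s+t≤n = small-violator-impossible T S s+t≤n violated
  -- Passing to (∁ S , ∁ T) lowers b s − a t by (b − a) (s + t − n) ≥ 0.
  ... | inj₂ n≤s+t = small-violator-impossible (∁ S) (∁ T) t′+s′≤n
    (subst₂ (λ k f → b * t′ + k + 1 ≤ a * s′ + f) (≡-sym k-dual) (≡-sym f-dual) violated′)
    where
    s t s′ t′ k f : ℕ
    s = ∣ S ∣
    t = ∣ T ∣
    s′ = ∣ ∁ S ∣
    t′ = ∣ ∁ T ∣
    k = between T (∁ S) (adj G)
    f = between (∁ T) S F
    -- Complementing and swapping `T` and `S` transposes the two blocks, which leaves the counts
    -- unchanged because `adj G` and `F` are symmetric.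
    k-dual : between (∁ S) (∁ (∁ T)) (adj G) ≡ k
    k-dual = trans (between-comm (∁ S) (∁ (∁ T)) (sym G)) (between-∁∁ T (∁ S) (adj G))
    f-dual : between (∁ (∁ S)) (∁ T) F ≡ f
    f-dual = trans (between-∁∁ S (∁ T) F) (between-comm S (∁ T) (singleEdge-sym i j))
    s+s′≡t+t′ : s + s′ ≡ t + t′
    s+s′≡t+t′ = trans (∣T∣+∣∁T∣≡n S) (≡-sym (∣T∣+∣∁T∣≡n T))
    t′≤s : t′ ≤ s
    t′≤s = +-cancelˡ-≤ t _ _ (≤-trans (≤-reflexive (∣T∣+∣∁T∣≡n T)) (≤-trans n≤s+t (≤-reflexive (+-comm s t))))
    t′+s′≤n : t′ + s′ ≤ n
    t′+s′≤n = ≤-trans (+-monoˡ-≤ s′ t′≤s) (≤-reflexive (∣T∣+∣∁T∣≡n S))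
    violated′ : b * t′ + k + 1 ≤ a * s′ + f
    violated′ with m≤n⇒∃[o]m+o≡n t′≤s
    ... | d , t′+d≡s = dual s t s′ t′ k f d t′+d≡s t≡ violated
      where
      t≡ : t ≡ s′ + d
      t≡ = +-cancelʳ-≡ t′ _ _ (trans (≡-sym s+s′≡t+t′) (trans (cong (_+ s′) (≡-sym t′+d≡s)) (rotate t′ d s′)))
        where
        rotate : ∀ p q r → p + q + r ≡ r + q + p
        rotate = solve-∀
      dual : ∀ s t s′ t′ k f d → t′ + d ≡ s → t ≡ s′ + d →
        b * s + k + 1 ≤ a * t + f → b * t′ + k + 1 ≤ a * s′ + f
      dual _ _ s′ t′ k f d refl refl vio = cancel-≤ (a * d + b * d)
        (+-mono-≤ vio (*-monoˡ-≤ d a≤b)) (lhs a b t′ d k) (rhs a b s′ d f)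
        where
        lhs : ∀ a b t′ d k → b * (t′ + d) + k + 1 + a * d ≡ a * d + b * d + (b * t′ + k + 1)
        lhs = solve-∀
        rhs : ∀ a b s′ d f → a * (s′ + d) + f + b * d ≡ a * d + b * d + (a * s′ + f)
        rhs = solve-∀

  factor-through : adj G i j ≡ true → ∃ (Factor a b)
  -- Augmentation starts from the forced edge alone, whose row and column sums are at most
  -- `2 ≤ a ≤ b`.
  factor-through Gij with factor-or-violator a b {F} a≤b (record
    { admissible = record { F⊆x = λ _ _ → id ; x⊆A = singleEdge⊆ i j G Gij }
    ; rows≤b     = row-F≤b
    ; cols≤b     = λ c → ≤-trans (≤-reflexive (sum-cong-≗ λ r → cong ι (singleEdge-sym i j r c))) (row-F≤b c)
    })
    where
    row-F≤b : ∀ r → row F r ≤ b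
    row-F≤b r = ≤-trans (singleEdge-row i j r) (≤-trans 2≤a a≤b)
  ... | inj₁ factor   = factor
  ... | inj₂ violator = ⊥-elim (violator-impossible violator)

theorem1p7 : (a b n : ℕ) → 2 ≤ a → a ≤ b → (G : Graph n) → Connected G →
    8 * a + 5 * b + 22 ≤ 2 * n → minDegree≥ G (a + 1) →
    ((n ∸ b ∸ 1) C 2) + a * b + 2 * a + b + 1 ≤ numEdges G →
    FracCovered G a b
theorem1p7 a b n 2≤a a≤b G _ large δ≥a+1 many i j Gij =
  ForcedEdge.factor⇒fractional G i j (factor-through 2≤a a≤b G large δ≥a+1 many i j Gij)
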